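{- Let $k$ be a positive integer, let $p\in(0,1]$, and let $\mathcal{A}$ be a monotone family of subsets of $[n]$ with minterms of size at most $k$ which is tame with respect to $p$. Then $$\mu_p(\mathcal{A})\ \ge\ \frac{\min\{\mathbb{E}_p[X^{\mathcal{A}}],\,1\}}{k2^k}.$$
   Context: Let $[n]=\{0,1,\ldots,n\}$. For $p\in[0,1]$, $[n]_p$ is a random subset of $[n]$ containing each element independently with probability $p$, and $\mu_p(\mathcal{A})=\Pr([n]_p\in\mathcal{A})$. A family $\mathcal{A}$ is monotone if $A\in\mathcal{A}$ and $A\subset B\subseteq [n]$ imply $B\in\mathcal{A}$. Minterms of $\mathcal{A}$ are its inclusion-minimal members; $\mathcal{M}(\mathcal{A})$ is the set of minterms. $X^{\mathcal{A}}$ is the random variable counting the minterms of $\mathcal{A}$ contained in $[n]_p$, and $\mathbb{E}_p[X^{\mathcal{A}}]=\sum_{M\in\mathcal{M}(\mathcal{A})}p^{|M|}$ is its expectation. For $V\subset[n]$ (possibly empty) and $m\ge1$, the family of $m$-supplements of $V$ with respect to $\mathcal{A}$ is $$N^m_{\mathcal{A}}(V)=\{W\subset[n] : |W|=m,\ W\cap V=\varnothing,\ W\cup V\in\mathcal{M}(\mathcal{A})\}.$$ A monotone family $\mathcal{A}$ with minterms of size at most $k$ is tame with respect to $p$ if for every $1\le m\le k-1$ and every $V\subset[n]$ one has $|N^m_{\mathcal{A}}(V)|<p^{ -m}$. -}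

module Defs where

open import Algebra.Apartness.Bundles using (HeytingCommutativeRing; HeytingField)
import Algebra.Apartness.Properties.HeytingCommutativeRing as HeytingProperties
open import Algebra.Bundles using (CommutativeRing; Semiring)
import Algebra.Definitions.RawSemiring as RawSemiringDefinitions
import Algebra.Properties.Ring as RingProperties
open import Data.Bool.Base using (if_then_else_)
import Data.Bool.Properties as Bool
open import Data.Empty using (⊥-elim)
open import Data.Fin.Subset
  using (Subset; inside; outside; _⊆_; _∩_; _∪_; ∣_∣) renaming (⊥ to ∅)
open import Data.Fin.Subset.Properties using (_⊆?_; anySubset?)
open import Data.List.Base as List using (List; []; _∷_; _++_; filter; length)
open import Data.Nat.Base as ℕ using (ℕ; zero; suc; NonZero)
import Data.Nat.Properties as ℕ
open import Data.Product.Base using (∃; _×_; _,_; proj₁; proj₂)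
open import Data.Sum.Base using (_⊎_; inj₁; inj₂)
open import Data.Vec.Base using ([]; _∷_; lookup)
open import Data.Vec.Properties using (≡-dec)
open import Function.Base using (it)
open import Function.Bundles using (_⇔_; Equivalence)
open import Level using (Level; _⊔_) renaming (suc to lsuc)
open import Relation.Binary.Core using (Rel)
open import Relation.Binary.Definitions using (DecidableEquality)
open import Relation.Binary.Lattice.Definitions using (Infimum)
open import Relation.Binary.PropositionalEquality.Core using (_≡_)
open import Relation.Binary.Structures using (IsStrictPartialOrder)
open import Relation.Nullary using (¬_; Dec; map′; ¬?; _×-dec_)
open import Relation.Nullary.Decidable using (decidable-stable)
open import Relation.Unary using (Pred; Decidable)

private
  variable
    a : Level
    N : ℕ

-- The standard library has no real numbers, so the scalars range over an
-- arbitrary ordered field, in the constructive sense: the order is linear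
-- only up to the (tight) apartness, and `x ≤ y` means `¬ (y < x)`.  The
-- Dedekind or Cauchy reals are a model, with no appeal to excluded middle;
-- classically the models are exactly the linearly ordered fields.  As `≤`
-- need not be total, minima are part of the structure.
record OrderedField c ℓ₁ ℓ₂ : Set (lsuc (c ⊔ ℓ₁ ⊔ ℓ₂)) where
  infix  4 _<_ _≤_
  infixl 7 _⊓_
  field
    heytingField : HeytingField c ℓ₁ ℓ₂

  open HeytingField heytingField public

  field
    _<_                  : Rel Carrier ℓ₂
    isStrictPartialOrder : IsStrictPartialOrder _≈_ _<_
    #⇔<⊎>                : ∀ {x y} → x # y ⇔ (x < y ⊎ y < x)
    +-monoˡ-<            : ∀ z {x y} → x < y → x + z < y + z
    *-pos                : ∀ {x y} → 0# < x → 0# < y → 0# < x * y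

  _≤_ : Rel Carrier ℓ₂
  x ≤ y = ¬ (y < x)

  field
    _⊓_     : Carrier → Carrier → Carrier
    infimum : Infimum _≤_ _⊓_

  infix  4 _≥_
  infixl 7 _/ℕ_

  _≥_ : Rel Carrier ℓ₂
  x ≥ y = y ≤ x

  open IsStrictPartialOrder isStrictPartialOrder public
    using (<-respʳ-≈; <-respˡ-≈)
    renaming (irrefl to <-irrefl; trans to <-trans)

  open HeytingCommutativeRing (HeytingField.heytingCommutativeRing heytingField) public
    using (commutativeRing)

  open CommutativeRing commutativeRing public
    using (ring; semiring)

  open RawSemiringDefinitions (Semiring.rawSemiring semiring) public
    using (_^_; product) renaming (_×_ to _·_)

  private
    module HP = HeytingProperties (HeytingField.heytingCommutativeRing heytingField)
    module RP = RingProperties ring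

  pos⇒# : ∀ {x} → 0# < x → x # 0#
  pos⇒# 0<x = Equivalence.from #⇔<⊎> (inj₂ 0<x)

  inverse : ∀ x → 0# < x → Carrier
  inverse x 0<x = proj₁ (#⇒invertible (pos⇒# 0<x))

  -- `#⇒invertible` inverts x - 0#, so this is not definitional.
  inverseˡ : ∀ x (0<x : 0# < x) → inverse x 0<x * x ≈ 1#
  inverseˡ x 0<x =
    trans (*-congˡ (sym (HP.x-0≈x x))) (proj₁ (proj₂ (#⇒invertible (pos⇒# 0<x))))

  0<1 : 0# < 1#
  0<1 with Equivalence.to #⇔<⊎> HP.1#0
  ... | inj₂ 0<1 = 0<1
  ... | inj₁ 1<0 = ⊥-elim (<-irrefl refl (<-trans 1<0 0<1′))
    where
    0<-1 : 0# < - 1#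
    0<-1 = <-respʳ-≈ (+-identityˡ (- 1#))
             (<-respˡ-≈ (-‿inverseʳ 1#) (+-monoˡ-< (- 1#) 1<0))
    0<1′ : 0# < 1#
    0<1′ = <-respʳ-≈
             (trans (RP.-1*x≈-x (- 1#)) (RP.-‿involutive 1#))
             (*-pos 0<-1 0<-1)

  fromℕ : ℕ → Carrier
  fromℕ n = n · 1#

  fromℕ-pos : ∀ n .{{_ : NonZero n}} → 0# < fromℕ n
  fromℕ-pos (suc zero)    = <-respʳ-≈ (sym (+-identityʳ 1#)) 0<1
  fromℕ-pos (suc (suc n)) =
    <-trans (fromℕ-pos (suc n))
            (<-respˡ-≈ (+-identityˡ (fromℕ (suc n))) (+-monoˡ-< (fromℕ (suc n)) 0<1))

  _/ℕ_ : Carrier → (n : ℕ) .{{_ : NonZero n}} → Carrier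
  x /ℕ n = x * inverse (fromℕ n) (fromℕ-pos n)

instance
  k*2^k≢0 : ∀ {k} .{{_ : NonZero k}} → NonZero (k ℕ.* 2 ℕ.^ k)
  k*2^k≢0 {k} = ℕ.m*n≢0 k (2 ℕ.^ k) {{it}} {{ℕ.m^n≢0 2 k}}

------------------------------------------------------------------------
-- Families of subsets of an N-element set.  A family is a predicate; its
-- decidability is carried along separately where members are counted.

_≟_ : DecidableEquality (Subset N)
_≟_ = ≡-dec Bool._≟_

subsets : ∀ N → List (Subset N)
subsets zero    = [] ∷ []
subsets (suc N) = List.map (inside ∷_) (subsets N) ++ List.map (outside ∷_) (subsets N)

count : {P : Pred (Subset N) a} → Decidable P → ℕ
count {N = N} P? = length (filter P? (subsets N))

Monotone : Pred (Subset N) a → Set a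
Monotone A = ∀ {S T} → A S → S ⊆ T → A T

Minterm : Pred (Subset N) a → Pred (Subset N) a
Minterm A M = A M × (∀ {B} → A B → B ⊆ M → B ≡ M)

minterm? : {A : Pred (Subset N) a} → Decidable A → Decidable (Minterm A)
minterm? {A = A} A? M = A? M ×-dec map′ to from (¬? (anySubset? smaller?))
  where
  smaller? : Decidable (λ B → A B × B ⊆ M × ¬ (B ≡ M))
  smaller? B = A? B ×-dec B ⊆? M ×-dec ¬? (B ≟ M)
  to : ¬ (∃ λ B → A B × B ⊆ M × ¬ (B ≡ M)) →
       ∀ {B} → A B → B ⊆ M → B ≡ M
  to none {B} AB B⊆M = decidable-stable (B ≟ M) (λ B≢M → none (B , AB , B⊆M , B≢M))
  from : (∀ {B} → A B → B ⊆ M → B ≡ M) →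
         ¬ (∃ λ B → A B × B ⊆ M × ¬ (B ≡ M))
  from min (B , AB , B⊆M , B≢M) = B≢M (min AB B⊆M)

MintermsOfSizeAtMost : ℕ → Pred (Subset N) a → Set a
MintermsOfSizeAtMost k A = ∀ {M} → Minterm A M → ∣ M ∣ ℕ.≤ k

-- The m-supplements of V with respect to A.
Supplement : Pred (Subset N) a → ℕ → Subset N → Pred (Subset N) a
Supplement A m V W = ∣ W ∣ ≡ m × W ∩ V ≡ ∅ × Minterm A (W ∪ V)

supplement? : {A : Pred (Subset N) a} → Decidable A →
              ∀ m V → Decidable (Supplement A m V)
supplement? A? m V W = ∣ W ∣ ℕ.≟ m ×-dec (W ∩ V) ≟ ∅ ×-dec minterm? A? (W ∪ V)

-- The number of minterms of A contained in S.
X : {A : Pred (Subset N) a} → Decidable A → Subset N → ℕ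
X A? S = count (λ M → minterm? A? M ×-dec M ⊆? S)

module RandomSubset {c ℓ₁ ℓ₂} (F : OrderedField c ℓ₁ ℓ₂) where
  open OrderedField F

  sumOver : List (Subset N) → (Subset N → Carrier) → Carrier
  sumOver Ss f = List.foldr _+_ 0# (List.map f Ss)

  -- The probability that the random subset, containing each element
  -- independently with probability p, is equal to S.
  weight : Carrier → Subset N → Carrier
  weight p S = product (λ i → if lookup S i then p else 1# - p)

  Pr : Carrier → {P : Pred (Subset N) a} → Decidable P → Carrier
  Pr {N = N} p P? = sumOver (filter P? (subsets N)) (weight p)

  𝔼 : Carrier → (Subset N → Carrier) → Carrier
  𝔼 {N = N} p f = sumOver (subsets N) (λ S → weight p S * f S)

  μ : Carrier → {A : Pred (Subset N) a} → Decidable A → Carrier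
  μ p A? = Pr p A?

  Tame : ℕ → (p : Carrier) → 0# < p → {A : Pred (Subset N) a} → Decidable A → Set ℓ₂
  Tame {N = N} k p 0<p A? =
    ∀ m (V : Subset N) → 1 ℕ.≤ m → m ℕ.≤ k ℕ.∸ 1 →
    fromℕ (count (supplement? A? m V)) < inverse p 0<p ^ m

{-# OPTIONS --safe #-}
module Submission where

-- The second moment method.  Writing E for the expected number of minterms,
-- E[X²] is the sum of p^|M ∪ M′| over pairs of minterms.  For fixed M write
-- M′ = W ∪ V with V = M′ ∩ M: the case V = M contributes 1, V = ∅ at most E, and
-- each other V at most k - 1 by tameness, so E[X²] ≤ E D with
-- D = 1 + E + 2^k (k - 1).  As 2 λ X ≤ 1_A + (λ X)² pointwise, taking
-- expectations with λ = 1 / D gives μ_p(A) ≥ E / D, and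
-- min(E, 1) D ≤ E (2 + 2^k (k - 1)) ≤ E k 2^k.

open import Algebra.Bundles using (CommutativeRing)
import Algebra.Properties.CommutativeSemigroup as CommutativeSemigroupProperties
import Algebra.Properties.CommutativeSemiring.Exp as ExpProperties
import Algebra.Properties.Group as GroupProperties
import Algebra.Properties.Monoid.Mult as MultProperties
import Algebra.Properties.Ring as RingProperties
import Algebra.Properties.Semiring.Exp as SemiringExpProperties
import Algebra.Properties.Semiring.Mult as SemiringMultProperties
import Algebra.Solver.Ring.NaturalCoefficients.Default as Solver
open import Data.Bool.Base using (Bool; true; false; if_then_else_)
open import Data.Empty using (⊥-elim)
open import Data.Fin.Subset using (Subset; inside; outside; _∈_; _⊆_; _∩_; _∪_; ∣_∣)
  renaming (⊥ to ∅)
open import Data.Fin.Subset.Properties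
  using (_⊆?_; ⊆-refl; ⊆-trans; drop-∷-⊆; p⊆p∪q; q⊆p∪q; ∪-identityˡ; ∪-identityʳ; ∣⊥∣≡0;
         p⊆q⇒∣p∣≤∣q∣; x∈p∪q⁻; x∈p∩q⁺; x∈p∩q⁻; Empty-unique; ∉⊥)
open import Data.List.Base using (List; []; _∷_; _++_; map; filter; foldr; length; applyUpTo)
open import Data.List.Membership.Propositional using () renaming (_∈_ to _∈ˡ_)
open import Data.List.Membership.Propositional.Properties using (∈-applyUpTo⁺; ∈-applyUpTo⁻)
open import Data.List.Properties using (length-applyUpTo)
open import Data.List.Relation.Unary.Any as Any using (there)
open import Data.Nat.Base as ℕ using (ℕ; zero; suc; NonZero; z≤n; s≤s)
  renaming (_*_ to _*ℕ_; _^_ to _^ℕ_)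
import Data.Nat.Properties as ℕ
open import Data.Product.Base using (∃; _×_; _,_; proj₁; proj₂)
open import Data.Sum.Base using (inj₁; inj₂; [_,_])
open import Data.Vec.Base using ([]; _∷_; here)
open import Data.Vec.Properties using (∷-injectiveʳ)
open import Function.Base using (_∘_)
open import Function.Bundles using (Equivalence)
open import Level using (Level)
open import Relation.Binary.Bundles using (Poset)
import Relation.Binary.PropositionalEquality as ≡
open import Relation.Binary.PropositionalEquality using (_≡_)
import Relation.Binary.Reasoning.PartialOrder as PartialOrderReasoning
open import Relation.Nullary using (¬_; Dec; does; yes; no; _×-dec_; _because_)
open import Relation.Nullary.Decidable using (dec-true; dec-false)
open import Relation.Unary using (Pred; Decidable)
open import Defs

private
  variable
    a b : Level
    N : ℕ

module OrderedFieldProperties {c ℓ₁ ℓ₂} (F : OrderedField c ℓ₁ ℓ₂) where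
  open OrderedField F
  open CommutativeRing commutativeRing
    using (commutativeSemiring; +-group; +-commutativeSemigroup)
  open GroupProperties +-group
    using () renaming (//-rightDividesʳ to x+y-y≈x; //-rightDividesˡ to x-y+y≈x)
  open RingProperties ring using (-‿distribˡ-*; -‿distribʳ-*; -‿involutive)
  open ExpProperties commutativeSemiring using (^-distrib-*)
  open SemiringExpProperties semiring using (^-congˡ)
  open Solver commutativeSemiring using (solve; _:=_; _:+_; _:*_; con)

  ≤-reflexive : ∀ {x y} → x ≈ y → x ≤ y
  ≤-reflexive x≈y = <-irrefl (sym x≈y)

  ≤-trans : ∀ {x y z} → x ≤ y → y ≤ z → x ≤ z
  ≤-trans {x} {y} {z} x≤y y≤z z<x
    with #-cotrans (Equivalence.from #⇔<⊎> (inj₁ z<x)) y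
  ... | inj₁ z#y = [ y≤z , (λ y<z → x≤y (<-trans y<z z<x)) ] (Equivalence.to #⇔<⊎> z#y)
  ... | inj₂ y#x = [ x≤y , (λ x<y → y≤z (<-trans z<x x<y)) ] (Equivalence.to #⇔<⊎> y#x)

  ≤-antisym : ∀ {x y} → x ≤ y → y ≤ x → x ≈ y
  ≤-antisym {x} {y} x≤y y≤x =
    proj₁ (tight x y) (λ x#y → [ y≤x , x≤y ] (Equivalence.to #⇔<⊎> x#y))

  <⇒≤ : ∀ {x y} → x < y → x ≤ y
  <⇒≤ x<y y<x = <-irrefl refl (<-trans x<y y<x)

  poset : Poset c ℓ₁ ℓ₂
  poset = record
    { _≈_ = _≈_
    ; _≤_ = _≤_
    ; isPartialOrder = record
      { isPreorder = record
        { isEquivalence = isEquivalence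
        ; reflexive     = ≤-reflexive
        ; trans         = ≤-trans
        }
      ; antisym = ≤-antisym
      }
    }

  open PartialOrderReasoning poset

  ≤-refl : ∀ {x} → x ≤ x
  ≤-refl = ≤-reflexive refl

  +-monoˡ-≤ : ∀ z {x y} → x ≤ y → x + z ≤ y + z
  +-monoˡ-≤ z {x} {y} x≤y y+z<x+z =
    x≤y (<-respʳ-≈ (x+y-y≈x z x) (<-respˡ-≈ (x+y-y≈x z y) (+-monoˡ-< (- z) y+z<x+z)))

  +-monoʳ-≤ : ∀ z {x y} → x ≤ y → z + x ≤ z + y
  +-monoʳ-≤ z {x} {y} x≤y = begin
    z + x  ≈⟨ +-comm z x ⟩
    x + z  ≤⟨ +-monoˡ-≤ z x≤y ⟩
    y + z  ≈⟨ +-comm y z ⟩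
    z + y  ∎

  +-mono-≤ : ∀ {x y u v} → x ≤ y → u ≤ v → x + u ≤ y + v
  +-mono-≤ {y = y} {u} x≤y u≤v = ≤-trans (+-monoˡ-≤ u x≤y) (+-monoʳ-≤ y u≤v)

  +-cancelʳ-≤ : ∀ z {x y} → x + z ≤ y + z → x ≤ y
  +-cancelʳ-≤ z {x} {y} x+z≤y+z = begin
    x            ≈⟨ x+y-y≈x z x ⟨
    x + z - z    ≤⟨ +-monoˡ-≤ (- z) x+z≤y+z ⟩
    y + z - z    ≈⟨ x+y-y≈x z y ⟩
    y            ∎

  0≤x+y : ∀ {x y} → 0# ≤ x → 0# ≤ y → 0# ≤ x + y
  0≤x+y 0≤x 0≤y = ≤-trans (≤-reflexive (sym (+-identityˡ 0#))) (+-mono-≤ 0≤x 0≤y)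

  x≤x+y : ∀ {x y} → 0# ≤ y → x ≤ x + y
  x≤x+y {x} 0≤y = ≤-trans (≤-reflexive (sym (+-identityʳ x))) (+-monoʳ-≤ x 0≤y)

  y≤x+y : ∀ {x y} → 0# ≤ x → y ≤ x + y
  y≤x+y {y = y} 0≤x = ≤-trans (≤-reflexive (sym (+-identityˡ y))) (+-monoˡ-≤ y 0≤x)

  x≤y⇒0≤y-x : ∀ {x y} → x ≤ y → 0# ≤ y - x
  x≤y⇒0≤y-x {x} x≤y = ≤-trans (≤-reflexive (sym (-‿inverseʳ x))) (+-monoˡ-≤ (- x) x≤y)

  x<0⇒0<-x : ∀ {x} → x < 0# → 0# < - x
  x<0⇒0<-x {x} x<0 =
    <-respʳ-≈ (+-identityˡ (- x)) (<-respˡ-≈ (-‿inverseʳ x) (+-monoˡ-< (- x) x<0))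

  0≤x*y : ∀ {x y} → 0# ≤ x → 0# ≤ y → 0# ≤ x * y
  0≤x*y {x} {y} 0≤x 0≤y xy<0 =
    <-irrefl (trans (*-congʳ (≤-antisym x≤0 0≤x)) (zeroˡ y)) xy<0
    where
    x≤0 : x ≤ 0#
    x≤0 0<x = <-irrefl (trans (*-congˡ (≤-antisym y≤0 0≤y)) (zeroʳ x)) xy<0
      where
      y≤0 : y ≤ 0#
      y≤0 0<y = <⇒≤ xy<0 (*-pos 0<x 0<y)

  0≤x*x : ∀ x → 0# ≤ x * x
  0≤x*x x xx<0 = 0≤x*y 0≤x 0≤x xx<0
    where
    0≤x : 0# ≤ x
    0≤x x<0 = <⇒≤ xx<0 (<-respʳ-≈ -x*-x≈xx (*-pos (x<0⇒0<-x x<0) (x<0⇒0<-x x<0)))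
      where
      -x*-x≈xx : - x * - x ≈ x * x
      -x*-x≈xx = trans (sym (-‿distribˡ-* x (- x)))
                   (trans (-‿cong (sym (-‿distribʳ-* x x))) (-‿involutive (x * x)))

  *-monoʳ-≤ : ∀ {z x y} → 0# ≤ z → x ≤ y → z * x ≤ z * y
  *-monoʳ-≤ {z} {x} {y} 0≤z x≤y = begin
    z * x                  ≤⟨ y≤x+y (0≤x*y 0≤z (x≤y⇒0≤y-x x≤y)) ⟩
    z * (y - x) + z * x    ≈⟨ distribˡ z (y - x) x ⟨
    z * (y - x + x)        ≈⟨ *-congˡ (x-y+y≈x x y) ⟩
    z * y                  ∎

  *-monoˡ-≤ : ∀ {z x y} → 0# ≤ z → x ≤ y → x * z ≤ y * z
  *-monoˡ-≤ {z} {x} {y} 0≤z x≤y = begin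
    x * z  ≈⟨ *-comm x z ⟩
    z * x  ≤⟨ *-monoʳ-≤ 0≤z x≤y ⟩
    z * y  ≈⟨ *-comm z y ⟩
    y * z  ∎

  x+x≤1+x*x : ∀ x → x + x ≤ 1# + x * x
  x+x≤1+x*x x = begin
    x + x                            ≈⟨ +-cong x≈d+1 x≈d+1 ⟩
    (d + 1#) + (d + 1#)              ≤⟨ x≤x+y (0≤x*x d) ⟩
    ((d + 1#) + (d + 1#)) + d * d    ≈⟨ identity ⟩
    1# + (d + 1#) * (d + 1#)         ≈⟨ +-congˡ (*-cong x≈d+1 x≈d+1) ⟨
    1# + x * x                       ∎
    where
    d = x - 1#
    x≈d+1 : x ≈ d + 1#
    x≈d+1 = sym (x-y+y≈x 1# x)
    identity : ((d + 1#) + (d + 1#)) + d * d ≈ 1# + (d + 1#) * (d + 1#)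
    identity = solve 1 (λ d → (d :+ con 1) :+ (d :+ con 1) :+ d :* d :=
                              con 1 :+ (d :+ con 1) :* (d :+ con 1)) refl d

  0≤1 : 0# ≤ 1#
  0≤1 = <⇒≤ 0<1

  ⊓-monoˡ-≤ : ∀ z {x y} → x ≤ y → x ⊓ z ≤ y ⊓ z
  ⊓-monoˡ-≤ z {x} {y} x≤y =
    let x⊓z≤x , x⊓z≤z , _ = infimum x z
        _ , _ , greatest  = infimum y z
    in greatest (x ⊓ z) (≤-trans x⊓z≤x x≤y) x⊓z≤z

  <-≤-trans : ∀ {x y z} → x < y → y ≤ z → x < z
  <-≤-trans {x} {y} {z} x<y y≤z with #-cotrans (Equivalence.from #⇔<⊎> (inj₁ x<y)) z
  ... | inj₁ x#z = [ (λ x<z → x<z) , (λ z<x → ⊥-elim (y≤z (<-trans z<x x<y))) ]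
                     (Equivalence.to #⇔<⊎> x#z)
  ... | inj₂ z#y = [ (λ z<y → ⊥-elim (y≤z z<y)) , <-trans x<y ] (Equivalence.to #⇔<⊎> z#y)

  0≤inverse : ∀ x (0<x : 0# < x) → 0# ≤ inverse x 0<x
  0≤inverse x 0<x x⁻¹<0 = <⇒≤ 0<1 (<-respˡ-≈ (+-identityˡ 1#) 0+1<0)
    where
    0<-1 : 0# < - 1#
    0<-1 = <-respʳ-≈ (trans (sym (-‿distribˡ-* _ x)) (-‿cong (inverseˡ x 0<x)))
             (*-pos (x<0⇒0<-x x⁻¹<0) 0<x)
    0+1<0 : 0# + 1# < 0#
    0+1<0 = <-respʳ-≈ (-‿inverseˡ 1#) (+-monoˡ-< 1# 0<-1)

  0≤x^n : ∀ {x} → 0# ≤ x → ∀ n → 0# ≤ x ^ n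
  0≤x^n 0≤x zero    = 0≤1
  0≤x^n 0≤x (suc n) = 0≤x*y 0≤x (0≤x^n 0≤x n)

  1^n≈1 : ∀ n → 1# ^ n ≈ 1#
  1^n≈1 zero    = refl
  1^n≈1 (suc n) = trans (*-identityˡ _) (1^n≈1 n)

  x^n*inverse^n≈1 : ∀ x (0<x : 0# < x) n → x ^ n * inverse x 0<x ^ n ≈ 1#
  x^n*inverse^n≈1 x 0<x n = begin-equality
    x ^ n * inverse x 0<x ^ n    ≈⟨ *-comm _ _ ⟩
    inverse x 0<x ^ n * x ^ n    ≈⟨ ^-distrib-* (inverse x 0<x) x n ⟨
    (inverse x 0<x * x) ^ n      ≈⟨ ^-congˡ n (inverseˡ x 0<x) ⟩
    1# ^ n                       ≈⟨ 1^n≈1 n ⟩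
    1#                           ∎

  0≤fromℕ : ∀ n → 0# ≤ fromℕ n
  0≤fromℕ zero    = ≤-refl
  0≤fromℕ (suc n) = 0≤x+y 0≤1 (0≤fromℕ n)

  fromℕ-mono-≤ : ∀ {m n} → m ℕ.≤ n → fromℕ m ≤ fromℕ n
  fromℕ-mono-≤ {n = n} z≤n = 0≤fromℕ n
  fromℕ-mono-≤ (s≤s m≤n)   = +-monoʳ-≤ 1# (fromℕ-mono-≤ m≤n)

  𝟙 : {P : Set a} → Dec P → Carrier
  𝟙 P? = if does P? then 1# else 0#

  0≤𝟙 : {P : Set a} (P? : Dec P) → 0# ≤ 𝟙 P?
  0≤𝟙 (true  because _) = 0≤1
  0≤𝟙 (false because _) = ≤-refl

  𝟙-true : {P : Set a} (P? : Dec P) → P → 𝟙 P? ≡ 1#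
  𝟙-true P? p rewrite dec-true P? p = ≡.refl

  𝟙-false : {P : Set a} (P? : Dec P) → ¬ P → 𝟙 P? ≡ 0#
  𝟙-false P? ¬p rewrite dec-false P? ¬p = ≡.refl

  𝟙-cong : {P : Set a} {Q : Set b} (P? : Dec P) (Q? : Dec Q) →
           (P → Q) → (Q → P) → 𝟙 P? ≡ 𝟙 Q?
  𝟙-cong (yes p) Q? to from = ≡.sym (𝟙-true Q? (to p))
  𝟙-cong (no ¬p) Q? to from = ≡.sym (𝟙-false Q? (¬p ∘ from))

  𝟙-× : {P : Set a} {Q : Set b} (P? : Dec P) (Q? : Dec Q) → 𝟙 (P? ×-dec Q?) ≈ 𝟙 P? * 𝟙 Q?
  𝟙-× (true  because _) Q? = sym (*-identityˡ _)
  𝟙-× (false because _) Q? = sym (zeroˡ _)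

  𝟙*-≤ : {P : Set a} (P? : Dec P) {x y : Carrier} → 0# ≤ y → (P → x ≤ y) → 𝟙 P? * x ≤ y
  𝟙*-≤ (yes p) 0≤y x≤y = ≤-trans (≤-reflexive (*-identityˡ _)) (x≤y p)
  𝟙*-≤ (no ¬p) 0≤y x≤y = ≤-trans (≤-reflexive (zeroˡ _)) 0≤y

  𝟙*-mono-≤ : {P : Set a} (P? : Dec P) {x y : Carrier} → (P → x ≤ y) → 𝟙 P? * x ≤ 𝟙 P? * y
  𝟙*-mono-≤ (yes p) x≤y = *-monoʳ-≤ 0≤1 (x≤y p)
  𝟙*-mono-≤ (no ¬p) x≤y = ≤-reflexive (trans (zeroˡ _) (sym (zeroˡ _)))

  ∑ : {B : Set b} → List B → (B → Carrier) → Carrier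
  ∑ xs f = foldr _+_ 0# (map f xs)

  ∑-zero : {B : Set b} (xs : List B) → ∑ xs (λ _ → 0#) ≈ 0#
  ∑-zero []       = refl
  ∑-zero (x ∷ xs) = trans (+-identityˡ _) (∑-zero xs)

  ∑-distrib-+ : {B : Set b} (xs : List B) (f g : B → Carrier) →
                ∑ xs (λ x → f x + g x) ≈ ∑ xs f + ∑ xs g
  ∑-distrib-+ []       f g = sym (+-identityˡ 0#)
  ∑-distrib-+ (x ∷ xs) f g = trans (+-congˡ (∑-distrib-+ xs f g)) (interchange _ _ _ _)
    where open CommutativeSemigroupProperties +-commutativeSemigroup using (interchange)

  module _ {B : Set b} where

    ∑-mono-≤ : (xs : List B) {f g : B → Carrier} → (∀ x → f x ≤ g x) → ∑ xs f ≤ ∑ xs g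
    ∑-mono-≤ []       f≤g = ≤-refl
    ∑-mono-≤ (x ∷ xs) f≤g = +-mono-≤ (f≤g x) (∑-mono-≤ xs f≤g)

    ∑-mono-≤-∈ : (xs : List B) {f g : B → Carrier} →
                 (∀ {x} → x ∈ˡ xs → f x ≤ g x) → ∑ xs f ≤ ∑ xs g
    ∑-mono-≤-∈ []       f≤g = ≤-refl
    ∑-mono-≤-∈ (x ∷ xs) f≤g = +-mono-≤ (f≤g (Any.here ≡.refl)) (∑-mono-≤-∈ xs (f≤g ∘ there))

    ∑-cong : (xs : List B) {f g : B → Carrier} → (∀ x → f x ≈ g x) → ∑ xs f ≈ ∑ xs g
    ∑-cong []       f≈g = refl
    ∑-cong (x ∷ xs) f≈g = +-cong (f≈g x) (∑-cong xs f≈g)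

    0≤∑ : (xs : List B) {f : B → Carrier} → (∀ x → 0# ≤ f x) → 0# ≤ ∑ xs f
    0≤∑ []       0≤f = ≤-refl
    0≤∑ (x ∷ xs) 0≤f = 0≤x+y (0≤f x) (0≤∑ xs 0≤f)

    *-distribˡ-∑ : (y : Carrier) (xs : List B) (f : B → Carrier) →
                   y * ∑ xs f ≈ ∑ xs (λ x → y * f x)
    *-distribˡ-∑ y []       f = zeroʳ y
    *-distribˡ-∑ y (x ∷ xs) f = trans (distribˡ y _ _) (+-congˡ (*-distribˡ-∑ y xs f))

    *-distribʳ-∑ : (y : Carrier) (xs : List B) (f : B → Carrier) →
                   ∑ xs f * y ≈ ∑ xs (λ x → f x * y)
    *-distribʳ-∑ y []       f = zeroˡ y
    *-distribʳ-∑ y (x ∷ xs) f = trans (distribʳ y _ _) (+-congˡ (*-distribʳ-∑ y xs f))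

    ∑-++ : (xs ys : List B) (f : B → Carrier) → ∑ (xs ++ ys) f ≈ ∑ xs f + ∑ ys f
    ∑-++ []       ys f = sym (+-identityˡ _)
    ∑-++ (x ∷ xs) ys f = trans (+-congˡ (∑-++ xs ys f)) (sym (+-assoc _ _ _))

    ∑-map : {B′ : Set a} (h : B′ → B) (xs : List B′) (f : B → Carrier) →
            ∑ (map h xs) f ≡ ∑ xs (f ∘ h)
    ∑-map h []       f = ≡.refl
    ∑-map h (x ∷ xs) f = ≡.cong (f (h x) +_) (∑-map h xs f)

    ∑-comm : {B′ : Set a} (xs : List B) (ys : List B′) (f : B → B′ → Carrier) →
             ∑ xs (λ x → ∑ ys (f x)) ≈ ∑ ys (λ y → ∑ xs (λ x → f x y))
    ∑-comm []       ys f = sym (∑-zero ys)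
    ∑-comm (x ∷ xs) ys f = trans (+-congˡ (∑-comm xs ys f)) (sym (∑-distrib-+ ys (f x) _))

    ∑-1 : (xs : List B) → ∑ xs (λ _ → 1#) ≡ fromℕ (length xs)
    ∑-1 []       = ≡.refl
    ∑-1 (x ∷ xs) = ≡.cong (1# +_) (∑-1 xs)

    ∑-filter : {P : Pred B a} (P? : Decidable P) (xs : List B) (f : B → Carrier) →
               ∑ (filter P? xs) f ≈ ∑ xs (λ x → 𝟙 (P? x) * f x)
    ∑-filter P? []       f = refl
    ∑-filter P? (x ∷ xs) f with does (P? x)
    ... | true  = +-cong (sym (*-identityˡ _)) (∑-filter P? xs f)
    ... | false = trans (∑-filter P? xs f)
                    (trans (sym (+-identityˡ _)) (+-congʳ (sym (zeroˡ _))))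

    f[x]≤∑f : {xs : List B} {x : B} → x ∈ˡ xs → (f : B → Carrier) → (∀ y → 0# ≤ f y) →
              f x ≤ ∑ xs f
    f[x]≤∑f {_ ∷ xs} (Any.here ≡.refl) f 0≤f = x≤x+y (0≤∑ xs 0≤f)
    f[x]≤∑f (there x∈xs)           f 0≤f = ≤-trans (f[x]≤∑f x∈xs f 0≤f) (y≤x+y (0≤f _))

module SubsetSums {c ℓ₁ ℓ₂} (F : OrderedField c ℓ₁ ℓ₂) where
  open OrderedField F
  open OrderedFieldProperties F
  open RandomSubset F
  open CommutativeRing commutativeRing using (+-monoid; commutativeSemiring)
  open MultProperties +-monoid using (×-homo-+)
  open Solver commutativeSemiring using (solve; _:=_; _:+_; _:*_; con)
  open PartialOrderReasoning poset

  ∑-subsets-suc : (f : Subset (suc N) → Carrier) →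
    ∑ (subsets (suc N)) f ≈
    ∑ (subsets N) (λ S → f (inside ∷ S)) + ∑ (subsets N) (λ S → f (outside ∷ S))
  ∑-subsets-suc {N = N} f = trans (∑-++ (map (inside ∷_) (subsets N)) _ f)
    (reflexive (≡.cong₂ _+_ (∑-map (inside ∷_) (subsets N) f) (∑-map (outside ∷_) (subsets N) f)))

  fromℕ-count : {P : Pred (Subset N) a} (P? : Decidable P) →
                fromℕ (count P?) ≈ ∑ (subsets N) (λ S → 𝟙 (P? S))
  fromℕ-count {N = N} P? = begin-equality
    fromℕ (count P?)                          ≡⟨ ∑-1 (filter P? (subsets N)) ⟨
    ∑ (filter P? (subsets N)) (λ _ → 1#)      ≈⟨ ∑-filter P? (subsets N) _ ⟩
    ∑ (subsets N) (λ S → 𝟙 (P? S) * 1#)       ≈⟨ ∑-cong (subsets N) (λ S → *-identityʳ _) ⟩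
    ∑ (subsets N) (λ S → 𝟙 (P? S))            ∎

  ∑-𝟙≟ : (U : Subset N) → ∑ (subsets N) (λ S → 𝟙 (S ≟ U)) ≈ 1#
  ∑-𝟙≟ []                   = +-identityʳ 1#
  ∑-𝟙≟ {suc N} (inside ∷ U) = begin-equality
    ∑ (subsets (suc N)) (λ S → 𝟙 (S ≟ (inside ∷ U)))
      ≈⟨ ∑-subsets-suc {N = N} _ ⟩
    ∑ (subsets N) (λ S → 𝟙 (S ≟ U)) + ∑ (subsets N) (λ _ → 0#)
      ≈⟨ +-cong (∑-𝟙≟ U) (∑-zero (subsets N)) ⟩
    1# + 0#
      ≈⟨ +-identityʳ 1# ⟩
    1#  ∎
  ∑-𝟙≟ {suc N} (outside ∷ U) = begin-equality
    ∑ (subsets (suc N)) (λ S → 𝟙 (S ≟ (outside ∷ U)))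
      ≈⟨ ∑-subsets-suc {N = N} _ ⟩
    ∑ (subsets N) (λ _ → 0#) + ∑ (subsets N) (λ S → 𝟙 (S ≟ U))
      ≈⟨ +-cong (∑-zero (subsets N)) (∑-𝟙≟ U) ⟩
    0# + 1#
      ≈⟨ +-identityˡ 1# ⟩
    1#  ∎

  ∑-𝟙⊆ : (U : Subset N) → ∑ (subsets N) (λ S → 𝟙 (S ⊆? U)) ≈ fromℕ (2 ^ℕ ∣ U ∣)
  ∑-𝟙⊆ []                   = refl
  ∑-𝟙⊆ {suc N} (inside ∷ U) = begin-equality
    ∑ (subsets (suc N)) (λ S → 𝟙 (S ⊆? (inside ∷ U)))
      ≈⟨ ∑-subsets-suc {N = N} _ ⟩
    ∑ (subsets N) (λ S → 𝟙 (S ⊆? U)) + ∑ (subsets N) (λ S → 𝟙 (S ⊆? U))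
      ≈⟨ +-cong (∑-𝟙⊆ U) (trans (∑-𝟙⊆ U) (sym (+-identityʳ _))) ⟩
    fromℕ (2 ^ℕ ∣ U ∣) + (fromℕ (2 ^ℕ ∣ U ∣) + 0#)
      ≈⟨ +-congˡ (×-homo-+ 1# (2 ^ℕ ∣ U ∣) 0) ⟨
    fromℕ (2 ^ℕ ∣ U ∣) + fromℕ (2 ^ℕ ∣ U ∣ ℕ.+ 0)
      ≈⟨ ×-homo-+ 1# (2 ^ℕ ∣ U ∣) _ ⟨
    fromℕ (2 ^ℕ suc ∣ U ∣)  ∎
  ∑-𝟙⊆ {suc N} (outside ∷ U) = begin-equality
    ∑ (subsets (suc N)) (λ S → 𝟙 (S ⊆? (outside ∷ U)))
      ≈⟨ ∑-subsets-suc {N = N} _ ⟩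
    ∑ (subsets N) (λ _ → 0#) + ∑ (subsets N) (λ S → 𝟙 (S ⊆? U))
      ≈⟨ +-cong (∑-zero (subsets N)) (∑-𝟙⊆ U) ⟩
    0# + fromℕ (2 ^ℕ ∣ U ∣)
      ≈⟨ +-identityˡ _ ⟩
    fromℕ (2 ^ℕ ∣ U ∣)  ∎

  -- Every S is uniquely W ∪ V with V ⊆ M and W disjoint from M.
  ∑-split : (M : Subset N) (f : Subset N → Carrier) →
    ∑ (subsets N) f ≈
    ∑ (subsets N) (λ V → ∑ (subsets N) (λ W → 𝟙 (V ⊆? M) * 𝟙 ((W ∩ M) ≟ ∅) * f (W ∪ V)))
  ∑-split [] f =
    solve 1 (λ x → x :+ con 0 := con 1 :* con 1 :* x :+ con 0 :+ con 0) refl (f [])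
  ∑-split {suc N} (m ∷ M) f = begin-equality
    ∑ (subsets (suc N)) f
      ≈⟨ ∑-subsets-suc f ⟩
    ∑ (subsets N) (λ S → f (inside ∷ S)) + ∑ (subsets N) (λ S → f (outside ∷ S))
      ≈⟨ parts m ⟩
    (part m inside inside + part m inside outside) +
    (part m outside inside + part m outside outside)
      ≈⟨ +-cong (halves inside) (halves outside) ⟨
    ∑ (subsets N) (λ V → ∑ (subsets (suc N)) (term m (inside ∷ V))) +
    ∑ (subsets N) (λ V → ∑ (subsets (suc N)) (term m (outside ∷ V)))
      ≈⟨ ∑-subsets-suc (λ V → ∑ (subsets (suc N)) (term m V)) ⟨
    ∑ (subsets (suc N)) (λ V → ∑ (subsets (suc N)) (term m V))  ∎
    where
    term : Bool → Subset (suc N) → Subset (suc N) → Carrier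
    term m V W = 𝟙 (V ⊆? (m ∷ M)) * 𝟙 ((W ∩ (m ∷ M)) ≟ ∅) * f (W ∪ V)
    part : Bool → Bool → Bool → Carrier
    part m v w = ∑ (subsets N) (λ V → ∑ (subsets N) (λ W → term m (v ∷ V) (w ∷ W)))
    halves : ∀ v → ∑ (subsets N) (λ V → ∑ (subsets (suc N)) (term m (v ∷ V))) ≈
                   part m v inside + part m v outside
    halves v = trans (∑-cong (subsets N) (λ V → ∑-subsets-suc (term m (v ∷ V))))
                     (∑-distrib-+ (subsets N) _ _)
    vanish : {g : Subset N → Subset N → Carrier} → (∀ V W → g V W ≈ 0#) →
             ∑ (subsets N) (λ V → ∑ (subsets N) (g V)) ≈ 0#
    vanish g≈0 = trans (∑-cong (subsets N) (λ V →
                          trans (∑-cong (subsets N) (g≈0 V)) (∑-zero (subsets N))))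
                       (∑-zero (subsets N))
    0*x*y≈0 : ∀ x y → 0# * x * y ≈ 0#
    0*x*y≈0 x y = trans (*-congʳ (zeroˡ x)) (zeroˡ y)
    x*0*y≈0 : ∀ x y → x * 0# * y ≈ 0#
    x*0*y≈0 x y = trans (*-congʳ (zeroʳ x)) (zeroˡ y)
    parts : ∀ m →
      ∑ (subsets N) (λ S → f (inside ∷ S)) + ∑ (subsets N) (λ S → f (outside ∷ S)) ≈
      (part m inside inside + part m inside outside) +
      (part m outside inside + part m outside outside)
    parts inside = +-cong
      (trans (∑-split M (λ S → f (inside ∷ S)))
        (sym (trans (+-congʳ (vanish (λ V W → x*0*y≈0 _ _))) (+-identityˡ _))))
      (trans (∑-split M (λ S → f (outside ∷ S)))
        (sym (trans (+-congʳ (vanish (λ V W → x*0*y≈0 _ _))) (+-identityˡ _))))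
    parts outside = begin-equality
      ∑ (subsets N) (λ S → f (inside ∷ S)) + ∑ (subsets N) (λ S → f (outside ∷ S))
        ≈⟨ +-cong (∑-split M (λ S → f (inside ∷ S))) (∑-split M (λ S → f (outside ∷ S))) ⟩
      part outside outside inside + part outside outside outside
        ≈⟨ +-identityˡ _ ⟨
      0# + (part outside outside inside + part outside outside outside)
        ≈⟨ +-congʳ (trans (+-cong (vanish (λ V W → 0*x*y≈0 _ _)) (vanish (λ V W → 0*x*y≈0 _ _)))
                          (+-identityˡ 0#)) ⟨
      (part outside inside inside + part outside inside outside) +
      (part outside outside inside + part outside outside outside)  ∎

  module _ (p : Carrier) where

    ∑-weight-⊇ : (U : Subset N) → ∑ (subsets N) (λ S → weight p S * 𝟙 (U ⊆? S)) ≈ p ^ ∣ U ∣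
    ∑-weight-⊇ []              = trans (+-identityʳ _) (*-identityʳ 1#)
    ∑-weight-⊇ {suc N} (u ∷ U) = begin-equality
      ∑ (subsets (suc N)) (λ S → weight p S * 𝟙 ((u ∷ U) ⊆? S))
        ≈⟨ ∑-subsets-suc {N = N} _ ⟩
      ∑ (subsets N) (λ S → p * weight p S * 𝟙 ((u ∷ U) ⊆? (inside ∷ S))) +
      ∑ (subsets N) (λ S → (1# - p) * weight p S * 𝟙 ((u ∷ U) ⊆? (outside ∷ S)))
        ≈⟨ cases u ⟩
      p ^ ∣ u ∷ U ∣  ∎
      where
      factor : ∀ q → ∑ (subsets N) (λ S → q * weight p S * 𝟙 (U ⊆? S)) ≈ q * p ^ ∣ U ∣
      factor q = begin-equality
        ∑ (subsets N) (λ S → q * weight p S * 𝟙 (U ⊆? S))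
          ≈⟨ ∑-cong (subsets N) (λ S → *-assoc q _ _) ⟩
        ∑ (subsets N) (λ S → q * (weight p S * 𝟙 (U ⊆? S)))
          ≈⟨ *-distribˡ-∑ q (subsets N) _ ⟨
        q * ∑ (subsets N) (λ S → weight p S * 𝟙 (U ⊆? S))
          ≈⟨ *-congˡ (∑-weight-⊇ U) ⟩
        q * p ^ ∣ U ∣  ∎
      cases : ∀ u →
        ∑ (subsets N) (λ S → p * weight p S * 𝟙 ((u ∷ U) ⊆? (inside ∷ S))) +
        ∑ (subsets N) (λ S → (1# - p) * weight p S * 𝟙 ((u ∷ U) ⊆? (outside ∷ S)))
        ≈ p ^ ∣ u ∷ U ∣
      cases inside = trans
        (+-cong (factor p) (trans (∑-cong (subsets N) (λ S → zeroʳ _)) (∑-zero (subsets N))))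
        (+-identityʳ _)
      cases outside = begin-equality
        _                                        ≈⟨ +-cong (factor p) (factor (1# - p)) ⟩
        p * p ^ ∣ U ∣ + (1# - p) * p ^ ∣ U ∣     ≈⟨ distribʳ _ p (1# - p) ⟨
        (p + (1# - p)) * p ^ ∣ U ∣               ≈⟨ *-congʳ p+[1-p]≈1 ⟩
        1# * p ^ ∣ U ∣                           ≈⟨ *-identityˡ _ ⟩
        p ^ ∣ U ∣                                ∎
        where
        p+[1-p]≈1 : p + (1# - p) ≈ 1#
        p+[1-p]≈1 = trans (+-comm p (1# - p))
          (trans (+-assoc 1# (- p) p) (trans (+-congˡ (-‿inverseˡ p)) (+-identityʳ 1#)))

    0≤weight : 0# ≤ p → p ≤ 1# → (S : Subset N) → 0# ≤ weight p S
    0≤weight 0≤p p≤1 []            = 0≤1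
    0≤weight 0≤p p≤1 (inside  ∷ S) = 0≤x*y 0≤p (0≤weight 0≤p p≤1 S)
    0≤weight 0≤p p≤1 (outside ∷ S) = 0≤x*y (x≤y⇒0≤y-x p≤1) (0≤weight 0≤p p≤1 S)

∣p∣≡0⇒p≡∅ : (S : Subset N) → ∣ S ∣ ≡ 0 → S ≡ ∅
∣p∣≡0⇒p≡∅ []            _ = ≡.refl
∣p∣≡0⇒p≡∅ (outside ∷ S) e = ≡.cong (outside ∷_) (∣p∣≡0⇒p≡∅ S e)

∣M∪[W∪V]∣≡∣M∣+∣W∣ : (M V W : Subset N) → V ⊆ M → W ∩ M ≡ ∅ →
                    ∣ M ∪ (W ∪ V) ∣ ≡ ∣ M ∣ ℕ.+ ∣ W ∣
∣M∪[W∪V]∣≡∣M∣+∣W∣ [] [] [] _ _ = ≡.refl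
∣M∪[W∪V]∣≡∣M∣+∣W∣ (inside ∷ M) (_ ∷ V) (outside ∷ W) V⊆M e =
  ≡.cong suc (∣M∪[W∪V]∣≡∣M∣+∣W∣ M V W (drop-∷-⊆ V⊆M) (∷-injectiveʳ e))
∣M∪[W∪V]∣≡∣M∣+∣W∣ (outside ∷ M) (inside ∷ V) _ V⊆M _ with () ← V⊆M here
∣M∪[W∪V]∣≡∣M∣+∣W∣ (outside ∷ M) (outside ∷ V) (inside ∷ W) V⊆M e =
  ≡.trans (≡.cong suc (∣M∪[W∪V]∣≡∣M∣+∣W∣ M V W (drop-∷-⊆ V⊆M) (∷-injectiveʳ e)))
          (≡.sym (ℕ.+-suc ∣ M ∣ ∣ W ∣))
∣M∪[W∪V]∣≡∣M∣+∣W∣ (outside ∷ M) (outside ∷ V) (outside ∷ W) V⊆M e =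
  ∣M∪[W∪V]∣≡∣M∣+∣W∣ M V W (drop-∷-⊆ V⊆M) (∷-injectiveʳ e)

V⊆M∧W∩M≡∅⇒W∩V≡∅ : {M V W : Subset N} → V ⊆ M → W ∩ M ≡ ∅ → W ∩ V ≡ ∅
V⊆M∧W∩M≡∅⇒W∩V≡∅ {M = M} {V} {W} V⊆M W∩M≡∅ = Empty-unique λ (x , x∈W∩V) →
  let x∈W , x∈V = x∈p∩q⁻ W V x∈W∩V in
  ∉⊥ (≡.subst (x ∈_) W∩M≡∅ (x∈p∩q⁺ (x∈W , V⊆M x∈V)))

W∩V≡∅⇒∣V∣+∣W∣≤∣W∪V∣ : (V W : Subset N) → W ∩ V ≡ ∅ → ∣ V ∣ ℕ.+ ∣ W ∣ ℕ.≤ ∣ W ∪ V ∣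
W∩V≡∅⇒∣V∣+∣W∣≤∣W∪V∣ V W W∩V≡∅ =
  ≡.subst (ℕ._≤ ∣ W ∪ V ∣) (∣M∪[W∪V]∣≡∣M∣+∣W∣ V V W ⊆-refl W∩V≡∅)
    (p⊆q⇒∣p∣≤∣q∣ λ x∈ → [ q⊆p∪q W V , (λ x∈′ → x∈′) ] (x∈p∪q⁻ V (W ∪ V) x∈))

2+2^k*[k∸1]≤k*2^k : ∀ k .{{_ : NonZero k}} → 2 ℕ.+ 2 ^ℕ k *ℕ (k ℕ.∸ 1) ℕ.≤ k *ℕ 2 ^ℕ k
2+2^k*[k∸1]≤k*2^k (suc k) = ℕ.+-mono-≤
  (ℕ.*-monoʳ-≤ 2 (ℕ.m^n>0 2 k)) (ℕ.≤-reflexive (ℕ.*-comm (2 ^ℕ suc k) k))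

module SecondMoment {c ℓ₁ ℓ₂ a N} (F : OrderedField c ℓ₁ ℓ₂)
  (p : OrderedField.Carrier F)
  (0<p : OrderedField._<_ F (OrderedField.0# F) p)
  (p≤1 : OrderedField._≤_ F p (OrderedField.1# F))
  {A : Pred (Subset N) a} (A? : Decidable A) where

  open OrderedField F
  open RandomSubset F
  open OrderedFieldProperties F
  open SubsetSums F
  open CommutativeRing commutativeRing using (commutativeSemiring)
  open SemiringExpProperties semiring using (^-homo-*)
  open SemiringMultProperties semiring using (×1-homo-*)
  open Solver commutativeSemiring using (solve; _:=_; _:+_; _:*_; con)
  open PartialOrderReasoning poset

  private
    Ss = subsets N

    0≤p^ : ∀ j → 0# ≤ p ^ j
    0≤p^ = 0≤x^n (<⇒≤ 0<p)

    𝟙ₘ : Subset N → Carrier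
    𝟙ₘ M = 𝟙 (minterm? A? M)

    x : Subset N → Carrier
    x S = ∑ Ss (λ M → 𝟙ₘ M * 𝟙 (M ⊆? S))

  E : Carrier
  E = ∑ Ss (λ M → 𝟙ₘ M * p ^ ∣ M ∣)

  0≤E : 0# ≤ E
  0≤E = 0≤∑ Ss (λ M → 0≤x*y (0≤𝟙 (minterm? A? M)) (0≤p^ ∣ M ∣))

  fromℕ-X : ∀ S → fromℕ (X A? S) ≈ x S
  fromℕ-X S = trans (fromℕ-count (λ M → minterm? A? M ×-dec M ⊆? S))
                    (∑-cong Ss (λ M → 𝟙-× (minterm? A? M) (M ⊆? S)))

  ∑-weight-∑ : {B : Set b} (is : List B) (c : B → Carrier) (U : B → Subset N) →
    ∑ Ss (λ S → weight p S * ∑ is (λ i → c i * 𝟙 (U i ⊆? S))) ≈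
    ∑ is (λ i → c i * p ^ ∣ U i ∣)
  ∑-weight-∑ is c U = begin-equality
    ∑ Ss (λ S → weight p S * ∑ is (λ i → c i * 𝟙 (U i ⊆? S)))
      ≈⟨ ∑-cong Ss (λ S → *-distribˡ-∑ (weight p S) is _) ⟩
    ∑ Ss (λ S → ∑ is (λ i → weight p S * (c i * 𝟙 (U i ⊆? S))))
      ≈⟨ ∑-comm Ss is _ ⟩
    ∑ is (λ i → ∑ Ss (λ S → weight p S * (c i * 𝟙 (U i ⊆? S))))
      ≈⟨ ∑-cong is (λ i → ∑-cong Ss (λ S → x∙yz≈y∙xz (weight p S) (c i) _)) ⟩
    ∑ is (λ i → ∑ Ss (λ S → c i * (weight p S * 𝟙 (U i ⊆? S))))
      ≈⟨ ∑-cong is (λ i → *-distribˡ-∑ (c i) Ss _) ⟨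
    ∑ is (λ i → c i * ∑ Ss (λ S → weight p S * 𝟙 (U i ⊆? S)))
      ≈⟨ ∑-cong is (λ i → *-congˡ (∑-weight-⊇ p (U i))) ⟩
    ∑ is (λ i → c i * p ^ ∣ U i ∣)  ∎
    where
    open CommutativeSemigroupProperties
      (CommutativeRing.*-commutativeSemigroup commutativeRing) using (x∙yz≈y∙xz)

  first-moment : ∑ Ss (λ S → weight p S * x S) ≈ E
  first-moment = ∑-weight-∑ Ss 𝟙ₘ (λ M → M)

  𝔼X≈E : 𝔼 p (λ S → fromℕ (X A? S)) ≈ E
  𝔼X≈E = trans (∑-cong Ss (λ S → *-congˡ (fromℕ-X S))) first-moment

  second-moment : ∑ Ss (λ S → weight p S * (x S * x S)) ≈
                  ∑ Ss (λ M → 𝟙ₘ M * ∑ Ss (λ M′ → 𝟙ₘ M′ * p ^ ∣ M ∪ M′ ∣))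
  second-moment = begin-equality
    ∑ Ss (λ S → weight p S * (x S * x S))
      ≈⟨ ∑-cong Ss (λ S → *-congˡ (square S)) ⟩
    ∑ Ss (λ S → weight p S * ∑ Ss (λ M → pairs M S))
      ≈⟨ ∑-cong Ss (λ S → *-distribˡ-∑ (weight p S) Ss _) ⟩
    ∑ Ss (λ S → ∑ Ss (λ M → weight p S * pairs M S))
      ≈⟨ ∑-comm Ss Ss _ ⟩
    ∑ Ss (λ M → ∑ Ss (λ S → weight p S * pairs M S))
      ≈⟨ ∑-cong Ss (λ M → ∑-weight-∑ Ss (λ M′ → 𝟙ₘ M * 𝟙ₘ M′) (λ M′ → M ∪ M′)) ⟩
    ∑ Ss (λ M → ∑ Ss (λ M′ → 𝟙ₘ M * 𝟙ₘ M′ * p ^ ∣ M ∪ M′ ∣))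
      ≈⟨ ∑-cong Ss (λ M → trans (∑-cong Ss (λ M′ → *-assoc (𝟙ₘ M) _ _))
                                (sym (*-distribˡ-∑ (𝟙ₘ M) Ss _))) ⟩
    ∑ Ss (λ M → 𝟙ₘ M * ∑ Ss (λ M′ → 𝟙ₘ M′ * p ^ ∣ M ∪ M′ ∣))  ∎
    where
    pairs : Subset N → Subset N → Carrier
    pairs M S = ∑ Ss (λ M′ → 𝟙ₘ M * 𝟙ₘ M′ * 𝟙 ((M ∪ M′) ⊆? S))

    𝟙⊆*𝟙⊆ : ∀ M M′ S → 𝟙 (M ⊆? S) * 𝟙 (M′ ⊆? S) ≈ 𝟙 ((M ∪ M′) ⊆? S)
    𝟙⊆*𝟙⊆ M M′ S = trans (sym (𝟙-× (M ⊆? S) (M′ ⊆? S)))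
      (reflexive (𝟙-cong (M ⊆? S ×-dec M′ ⊆? S) ((M ∪ M′) ⊆? S)
        (λ (M⊆S , M′⊆S) x∈ → [ M⊆S , M′⊆S ] (x∈p∪q⁻ M M′ x∈))
        (λ M∪M′⊆S → ⊆-trans (p⊆p∪q M′) M∪M′⊆S , ⊆-trans (q⊆p∪q M M′) M∪M′⊆S)))

    square : ∀ S → x S * x S ≈ ∑ Ss (λ M → pairs M S)
    square S = begin-equality
      x S * x S
        ≈⟨ *-distribʳ-∑ (x S) Ss _ ⟩
      ∑ Ss (λ M → 𝟙ₘ M * 𝟙 (M ⊆? S) * x S)
        ≈⟨ ∑-cong Ss (λ M → *-distribˡ-∑ _ Ss _) ⟩
      ∑ Ss (λ M → ∑ Ss (λ M′ → 𝟙ₘ M * 𝟙 (M ⊆? S) * (𝟙ₘ M′ * 𝟙 (M′ ⊆? S))))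
        ≈⟨ ∑-cong Ss (λ M → ∑-cong Ss (λ M′ →
             trans (interchange _ _ _ _) (*-congˡ (𝟙⊆*𝟙⊆ M M′ S)))) ⟩
      ∑ Ss (λ M → pairs M S)  ∎
      where
      open CommutativeSemigroupProperties
        (CommutativeRing.*-commutativeSemigroup commutativeRing) using (interchange)

  module _ (k : ℕ) .{{_ : NonZero k}} (size≤k : MintermsOfSizeAtMost k A)
           (tame : Tame k p 0<p A?) where

    private
      js = applyUpTo suc (k ℕ.∸ 1)

      v+w≤k⇒w≤k∸1 : ∀ {v w} → 1 ℕ.≤ v → v ℕ.+ w ℕ.≤ k → w ℕ.≤ k ℕ.∸ 1
      v+w≤k⇒w≤k∸1 1≤v v+w≤k = ℕ.∸-monoˡ-≤ 1 (ℕ.≤-trans (ℕ.+-monoˡ-≤ _ 1≤v) v+w≤k)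

    D : Carrier
    D = 1# + (E + fromℕ (2 ^ℕ k) * fromℕ (k ℕ.∸ 1))

    supplements : Subset N → Subset N → Carrier
    supplements V W = ∑ js (λ j → 𝟙 (supplement? A? j V W) * p ^ j)

    -- The three ways in which W ∪ V can be a minterm for V ⊆ M: it is M, it is
    -- disjoint from M, or W is an m-supplement of V with 1 ≤ m ≤ k - 1.
    cover : Subset N → Subset N → Subset N → Carrier
    cover M V W = 𝟙 (V ≟ M) * 𝟙 (W ≟ ∅) +
                  (𝟙 (V ≟ ∅) * (𝟙ₘ W * p ^ ∣ W ∣) + 𝟙 (V ⊆? M) * supplements V W)

    0≤supplements : ∀ V W → 0# ≤ supplements V W
    0≤supplements V W = 0≤∑ js (λ j → 0≤x*y (0≤𝟙 (supplement? A? j V W)) (0≤p^ j))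

    0≤disjoint : (V W : Subset N) → 0# ≤ 𝟙 (V ≟ ∅) * (𝟙ₘ W * p ^ ∣ W ∣)
    0≤disjoint V W = 0≤x*y (0≤𝟙 (V ≟ ∅)) (0≤x*y (0≤𝟙 (minterm? A? W)) (0≤p^ ∣ W ∣))

    0≤proper : (M V W : Subset N) → 0# ≤ 𝟙 (V ⊆? M) * supplements V W
    0≤proper M V W = 0≤x*y (0≤𝟙 (V ⊆? M)) (0≤supplements V W)

    0≤equal : (M V W : Subset N) → 0# ≤ 𝟙 (V ≟ M) * 𝟙 (W ≟ ∅)
    0≤equal M V W = 0≤x*y (0≤𝟙 (V ≟ M)) (0≤𝟙 (W ≟ ∅))

    0≤cover : (M V W : Subset N) → 0# ≤ cover M V W
    0≤cover M V W = 0≤x+y (0≤equal M V W) (0≤x+y (0≤disjoint V W) (0≤proper M V W))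

    p^∣W∣≤cover : ∀ {M V W} → Minterm A M → V ⊆ M → W ∩ M ≡ ∅ → Minterm A (W ∪ V) →
                  p ^ ∣ W ∣ ≤ cover M V W
    p^∣W∣≤cover {M} {V} {W} (_ , M-least) V⊆M W∩M≡∅ minterm = cases (W ≟ ∅) (V ≟ ∅)
      where
      W∩V≡∅ : W ∩ V ≡ ∅
      W∩V≡∅ = V⊆M∧W∩M≡∅⇒W∩V≡∅ V⊆M W∩M≡∅

      cases : Dec (W ≡ ∅) → Dec (V ≡ ∅) → p ^ ∣ W ∣ ≤ cover M V W
      cases (yes W≡∅) _ = begin
        p ^ ∣ W ∣                  ≡⟨ ≡.cong (p ^_) (≡.trans (≡.cong ∣_∣ W≡∅) (∣⊥∣≡0 N)) ⟩
        1#                         ≈⟨ *-identityˡ 1# ⟨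
        1# * 1#                    ≡⟨ ≡.cong₂ _*_ (𝟙-true (V ≟ M) V≡M) (𝟙-true (W ≟ ∅) W≡∅) ⟨
        𝟙 (V ≟ M) * 𝟙 (W ≟ ∅)      ≤⟨ x≤x+y (0≤x+y (0≤disjoint V W) (0≤proper M V W)) ⟩
        cover M V W                ∎
        where
        V≡M : V ≡ M
        V≡M = M-least (≡.subst A (≡.trans (≡.cong (_∪ V) W≡∅) (∪-identityˡ V)) (proj₁ minterm)) V⊆M
      cases (no W≢∅) (yes V≡∅) = begin
        p ^ ∣ W ∣                                ≈⟨ trans (*-identityˡ _) (*-identityˡ _) ⟨
        1# * (1# * p ^ ∣ W ∣)                    ≡⟨ ≡.cong₂ (λ s t → s * (t * p ^ ∣ W ∣))
                                                     (𝟙-true (V ≟ ∅) V≡∅)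
                                                     (𝟙-true (minterm? A? W) W-minterm) ⟨
        𝟙 (V ≟ ∅) * (𝟙ₘ W * p ^ ∣ W ∣)           ≤⟨ x≤x+y (0≤proper M V W) ⟩
        _                                        ≤⟨ y≤x+y (0≤equal M V W) ⟩
        cover M V W                              ∎
        where
        W-minterm : Minterm A W
        W-minterm = ≡.subst (Minterm A) (≡.trans (≡.cong (W ∪_) V≡∅) (∪-identityʳ W)) minterm
      cases (no W≢∅) (no V≢∅) = begin
        p ^ ∣ W ∣
          ≈⟨ *-identityˡ _ ⟨
        1# * p ^ ∣ W ∣
          ≡⟨ ≡.cong (_* p ^ ∣ W ∣)
               (𝟙-true (supplement? A? ∣ W ∣ V W) (≡.refl , W∩V≡∅ , minterm)) ⟨
        𝟙 (supplement? A? ∣ W ∣ V W) * p ^ ∣ W ∣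
          ≤⟨ f[x]≤∑f ∣W∣∈js (λ j → 𝟙 (supplement? A? j V W) * p ^ j)
               (λ j → 0≤x*y (0≤𝟙 (supplement? A? j V W)) (0≤p^ j)) ⟩
        supplements V W
          ≈⟨ *-identityˡ _ ⟨
        1# * supplements V W
          ≡⟨ ≡.cong (_* supplements V W) (𝟙-true (V ⊆? M) V⊆M) ⟨
        𝟙 (V ⊆? M) * supplements V W
          ≤⟨ y≤x+y (0≤disjoint V W) ⟩
        𝟙 (V ≟ ∅) * (𝟙ₘ W * p ^ ∣ W ∣) + 𝟙 (V ⊆? M) * supplements V W
          ≤⟨ y≤x+y (0≤equal M V W) ⟩
        cover M V W  ∎
        where
        1≤∣V∣ : 1 ℕ.≤ ∣ V ∣
        1≤∣V∣ = ℕ.n≢0⇒n>0 (V≢∅ ∘ ∣p∣≡0⇒p≡∅ V)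

        ∣W∣≤k-1 : ∣ W ∣ ℕ.≤ k ℕ.∸ 1
        ∣W∣≤k-1 = v+w≤k⇒w≤k∸1 1≤∣V∣
          (ℕ.≤-trans (W∩V≡∅⇒∣V∣+∣W∣≤∣W∪V∣ V W W∩V≡∅) (size≤k minterm))

        n∈js : ∀ {n} → 1 ℕ.≤ n → n ℕ.≤ k ℕ.∸ 1 → n ∈ˡ js
        n∈js (s≤s _) n≤k-1 = ∈-applyUpTo⁺ suc n≤k-1

        ∣W∣∈js : ∣ W ∣ ∈ˡ js
        ∣W∣∈js = n∈js (ℕ.n≢0⇒n>0 (W≢∅ ∘ ∣p∣≡0⇒p≡∅ W)) ∣W∣≤k-1

    ∑-supplements : ∀ V → ∑ Ss (supplements V) ≤ fromℕ (k ℕ.∸ 1)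
    ∑-supplements V = begin
      ∑ Ss (supplements V)
        ≈⟨ ∑-comm Ss js _ ⟩
      ∑ js (λ j → ∑ Ss (λ W → 𝟙 (supplement? A? j V W) * p ^ j))
        ≤⟨ ∑-mono-≤-∈ js (λ {j} j∈js → level j (∈-applyUpTo⁻ suc j∈js)) ⟩
      ∑ js (λ _ → 1#)
        ≡⟨ ∑-1 js ⟩
      fromℕ (length js)
        ≡⟨ ≡.cong fromℕ (length-applyUpTo suc (k ℕ.∸ 1)) ⟩
      fromℕ (k ℕ.∸ 1)  ∎
      where
      level : ∀ j → (∃ λ i → i ℕ.< k ℕ.∸ 1 × j ≡ suc i) →
              ∑ Ss (λ W → 𝟙 (supplement? A? j V W) * p ^ j) ≤ 1#
      level j (i , i<k-1 , ≡.refl) = begin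
        ∑ Ss (λ W → 𝟙 (supplement? A? j V W) * p ^ j)
          ≈⟨ *-distribʳ-∑ (p ^ j) Ss _ ⟨
        ∑ Ss (λ W → 𝟙 (supplement? A? j V W)) * p ^ j
          ≈⟨ *-congʳ (fromℕ-count (supplement? A? j V)) ⟨
        fromℕ (count (supplement? A? j V)) * p ^ j
          ≤⟨ *-monoˡ-≤ (0≤p^ j) (<⇒≤ (tame j V (s≤s z≤n) i<k-1)) ⟩
        inverse p 0<p ^ j * p ^ j
          ≈⟨ *-comm _ _ ⟩
        p ^ j * inverse p 0<p ^ j
          ≈⟨ x^n*inverse^n≈1 p 0<p j ⟩
        1#  ∎

    ∑-cover : ∀ {M} → Minterm A M → ∑ Ss (λ V → ∑ Ss (cover M V)) ≤ D
    ∑-cover {M} minterm = begin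
      ∑ Ss (λ V → ∑ Ss (cover M V))
        ≤⟨ ∑-mono-≤ Ss row ⟩
      ∑ Ss (λ V → 𝟙 (V ≟ M) + (𝟙 (V ≟ ∅) * E + 𝟙 (V ⊆? M) * fromℕ (k ℕ.∸ 1)))
        ≈⟨ trans (∑-distrib-+ Ss _ _) (+-congˡ (∑-distrib-+ Ss _ _)) ⟩
      ∑ Ss (λ V → 𝟙 (V ≟ M)) +
      (∑ Ss (λ V → 𝟙 (V ≟ ∅) * E) + ∑ Ss (λ V → 𝟙 (V ⊆? M) * fromℕ (k ℕ.∸ 1)))
        ≈⟨ +-congˡ (+-cong (*-distribʳ-∑ E Ss _) (*-distribʳ-∑ _ Ss _)) ⟨
      ∑ Ss (λ V → 𝟙 (V ≟ M)) +
      (∑ Ss (λ V → 𝟙 (V ≟ ∅)) * E + ∑ Ss (λ V → 𝟙 (V ⊆? M)) * fromℕ (k ℕ.∸ 1))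
        ≈⟨ +-cong (∑-𝟙≟ M)
             (+-cong (trans (*-congʳ (∑-𝟙≟ {N} ∅)) (*-identityˡ E)) (*-congʳ (∑-𝟙⊆ M))) ⟩
      1# + (E + fromℕ (2 ^ℕ ∣ M ∣) * fromℕ (k ℕ.∸ 1))
        ≤⟨ +-monoʳ-≤ 1# (+-monoʳ-≤ E (*-monoˡ-≤ (0≤fromℕ (k ℕ.∸ 1))
             (fromℕ-mono-≤ (ℕ.^-monoʳ-≤ 2 (size≤k minterm))))) ⟩
      D  ∎
      where
      row : ∀ V → ∑ Ss (cover M V) ≤ 𝟙 (V ≟ M) + (𝟙 (V ≟ ∅) * E + 𝟙 (V ⊆? M) * fromℕ (k ℕ.∸ 1))
      row V = begin
        ∑ Ss (cover M V)
          ≈⟨ trans (∑-distrib-+ Ss _ _) (+-congˡ (∑-distrib-+ Ss _ _)) ⟩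
        ∑ Ss (λ W → 𝟙 (V ≟ M) * 𝟙 (W ≟ ∅)) +
        (∑ Ss (λ W → 𝟙 (V ≟ ∅) * (𝟙ₘ W * p ^ ∣ W ∣)) + ∑ Ss (λ W → 𝟙 (V ⊆? M) * supplements V W))
          ≈⟨ +-cong (*-distribˡ-∑ _ Ss _) (+-cong (*-distribˡ-∑ _ Ss _) (*-distribˡ-∑ _ Ss _)) ⟨
        𝟙 (V ≟ M) * ∑ Ss (λ W → 𝟙 (W ≟ ∅)) +
        (𝟙 (V ≟ ∅) * E + 𝟙 (V ⊆? M) * ∑ Ss (supplements V))
          ≤⟨ +-mono-≤ (≤-reflexive (trans (*-congˡ (∑-𝟙≟ {N} ∅)) (*-identityʳ _)))
               (+-monoʳ-≤ _ (*-monoʳ-≤ (0≤𝟙 (V ⊆? M)) (∑-supplements V))) ⟩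
        𝟙 (V ≟ M) + (𝟙 (V ≟ ∅) * E + 𝟙 (V ⊆? M) * fromℕ (k ℕ.∸ 1))  ∎

    ∑-p^∣M∪M′∣≤p^∣M∣*D : ∀ {M} → Minterm A M →
      ∑ Ss (λ M′ → 𝟙ₘ M′ * p ^ ∣ M ∪ M′ ∣) ≤ p ^ ∣ M ∣ * D
    ∑-p^∣M∪M′∣≤p^∣M∣*D {M} minterm = begin
      ∑ Ss (λ M′ → 𝟙ₘ M′ * p ^ ∣ M ∪ M′ ∣)
        ≈⟨ ∑-split M _ ⟩
      ∑ Ss (λ V → ∑ Ss (λ W →
        𝟙 (V ⊆? M) * 𝟙 ((W ∩ M) ≟ ∅) * (𝟙ₘ (W ∪ V) * p ^ ∣ M ∪ (W ∪ V) ∣)))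
        ≤⟨ ∑-mono-≤ Ss (λ V → ∑-mono-≤ Ss (pointwise V)) ⟩
      ∑ Ss (λ V → ∑ Ss (λ W → p ^ ∣ M ∣ * cover M V W))
        ≈⟨ trans (*-distribˡ-∑ _ Ss _) (∑-cong Ss (λ V → *-distribˡ-∑ _ Ss (cover M V))) ⟨
      p ^ ∣ M ∣ * ∑ Ss (λ V → ∑ Ss (cover M V))
        ≤⟨ *-monoʳ-≤ (0≤p^ ∣ M ∣) (∑-cover minterm) ⟩
      p ^ ∣ M ∣ * D  ∎
      where
      pointwise : ∀ V W →
        𝟙 (V ⊆? M) * 𝟙 ((W ∩ M) ≟ ∅) * (𝟙ₘ (W ∪ V) * p ^ ∣ M ∪ (W ∪ V) ∣) ≤ p ^ ∣ M ∣ * cover M V W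
      pointwise V W = begin
        𝟙 (V ⊆? M) * 𝟙 ((W ∩ M) ≟ ∅) * (𝟙ₘ (W ∪ V) * p ^ ∣ M ∪ (W ∪ V) ∣)
          ≈⟨ *-assoc _ _ _ ⟩
        𝟙 (V ⊆? M) * (𝟙 ((W ∩ M) ≟ ∅) * (𝟙ₘ (W ∪ V) * p ^ ∣ M ∪ (W ∪ V) ∣))
          ≤⟨ 𝟙*-≤ (V ⊆? M) 0≤rhs (λ V⊆M →
             𝟙*-≤ ((W ∩ M) ≟ ∅) 0≤rhs (λ W∩M≡∅ →
             𝟙*-≤ (minterm? A? (W ∪ V)) 0≤rhs (λ W∪V-minterm →
             (begin
               p ^ ∣ M ∪ (W ∪ V) ∣
                 ≡⟨ ≡.cong (p ^_) (∣M∪[W∪V]∣≡∣M∣+∣W∣ M V W V⊆M W∩M≡∅) ⟩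
               p ^ (∣ M ∣ ℕ.+ ∣ W ∣)
                 ≈⟨ ^-homo-* p ∣ M ∣ ∣ W ∣ ⟩
               p ^ ∣ M ∣ * p ^ ∣ W ∣
                 ≤⟨ *-monoʳ-≤ (0≤p^ ∣ M ∣) (p^∣W∣≤cover minterm V⊆M W∩M≡∅ W∪V-minterm) ⟩
               p ^ ∣ M ∣ * cover M V W  ∎)))) ⟩
        p ^ ∣ M ∣ * cover M V W  ∎
        where
        0≤rhs : 0# ≤ p ^ ∣ M ∣ * cover M V W
        0≤rhs = 0≤x*y (0≤p^ ∣ M ∣) (0≤cover M V W)

    second-moment-≤ : ∑ Ss (λ S → weight p S * (x S * x S)) ≤ E * D
    second-moment-≤ = begin
      ∑ Ss (λ S → weight p S * (x S * x S))
        ≈⟨ second-moment ⟩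
      ∑ Ss (λ M → 𝟙ₘ M * ∑ Ss (λ M′ → 𝟙ₘ M′ * p ^ ∣ M ∪ M′ ∣))
        ≤⟨ ∑-mono-≤ Ss (λ M → 𝟙*-mono-≤ (minterm? A? M) ∑-p^∣M∪M′∣≤p^∣M∣*D) ⟩
      ∑ Ss (λ M → 𝟙ₘ M * (p ^ ∣ M ∣ * D))
        ≈⟨ ∑-cong Ss (λ M → *-assoc _ _ D) ⟨
      ∑ Ss (λ M → 𝟙ₘ M * p ^ ∣ M ∣ * D)
        ≈⟨ *-distribʳ-∑ D Ss _ ⟨
      E * D  ∎

    0<D : 0# < D
    0<D = <-≤-trans 0<1 (x≤x+y (0≤x+y 0≤E (0≤x*y (0≤fromℕ (2 ^ℕ k)) (0≤fromℕ (k ℕ.∸ 1)))))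

    [E⊓1]*D≤E*[k*2^k] : (E ⊓ 1#) * D ≤ E * fromℕ (k *ℕ 2 ^ℕ k)
    [E⊓1]*D≤E*[k*2^k] = begin
      e * (1# + (E + B))           ≈⟨ trans (distribˡ e _ _) (+-congˡ (distribˡ e E B)) ⟩
      e * 1# + (e * E + e * B)     ≤⟨ +-mono-≤ (*-monoˡ-≤ 0≤1 e≤E)
                                        (+-mono-≤ (*-monoˡ-≤ 0≤E e≤1) (*-monoˡ-≤ 0≤B e≤E)) ⟩
      E * 1# + (1# * E + E * B)    ≈⟨ collect ⟩
      E * (1# + (1# + B))          ≈⟨ *-congˡ (+-congˡ (+-congˡ (×1-homo-* (2 ^ℕ k) (k ℕ.∸ 1)))) ⟨
      E * fromℕ (2 ℕ.+ 2 ^ℕ k *ℕ (k ℕ.∸ 1))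
                                   ≤⟨ *-monoʳ-≤ 0≤E (fromℕ-mono-≤ (2+2^k*[k∸1]≤k*2^k k)) ⟩
      E * fromℕ (k *ℕ 2 ^ℕ k)      ∎
      where
      e = E ⊓ 1#
      B = fromℕ (2 ^ℕ k) * fromℕ (k ℕ.∸ 1)
      e≤E : e ≤ E
      e≤E = proj₁ (infimum E 1#)
      e≤1 : e ≤ 1#
      e≤1 = proj₁ (proj₂ (infimum E 1#))
      0≤B : 0# ≤ B
      0≤B = 0≤x*y (0≤fromℕ (2 ^ℕ k)) (0≤fromℕ (k ℕ.∸ 1))
      collect : E * 1# + (1# * E + E * B) ≈ E * (1# + (1# + B))
      collect = solve 2 (λ E B → E :* con 1 :+ (con 1 :* E :+ E :* B) :=
                                 E :* (con 1 :+ (con 1 :+ B))) refl E B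

    private
      λ′ : Carrier
      λ′ = inverse D 0<D

      0≤λ′ : 0# ≤ λ′
      0≤λ′ = 0≤inverse D 0<D

    ¬A⇒x≈0 : Monotone A → ∀ {S} → ¬ A S → x S ≈ 0#
    ¬A⇒x≈0 mono {S} ¬AS = trans (∑-cong Ss (λ M →
        trans (sym (𝟙-× (minterm? A? M) (M ⊆? S)))
          (reflexive (𝟙-false (minterm? A? M ×-dec M ⊆? S)
            (λ ((AM , _) , M⊆S) → ¬AS (mono AM M⊆S))))))
      (∑-zero Ss)

    2λx≤𝟙+[λx]² : Monotone A → ∀ S →
      λ′ * x S + λ′ * x S ≤ 𝟙 (A? S) + (λ′ * x S) * (λ′ * x S)
    2λx≤𝟙+[λx]² mono S with A? S
    ... | yes _  = x+x≤1+x*x (λ′ * x S)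
    ... | no ¬AS = ≤-trans
      (≤-reflexive (trans (+-cong λx≈0 λx≈0) (+-identityˡ 0#)))
      (0≤x+y ≤-refl (0≤x*x (λ′ * x S)))
      where
      λx≈0 : λ′ * x S ≈ 0#
      λx≈0 = trans (*-congˡ (¬A⇒x≈0 mono ¬AS)) (zeroʳ λ′)

    λE≤μ : Monotone A → λ′ * E ≤ μ p A?
    λE≤μ mono = +-cancelʳ-≤ (λ′ * E) (begin
      λ′ * E + λ′ * E
        ≈⟨ +-cong λE≈ λE≈ ⟩
      ∑ Ss (λ S → weight p S * (λ′ * x S)) + ∑ Ss (λ S → weight p S * (λ′ * x S))
        ≈⟨ trans (∑-cong Ss (λ S → distribˡ _ _ _)) (∑-distrib-+ Ss _ _) ⟨
      ∑ Ss (λ S → weight p S * (λ′ * x S + λ′ * x S))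
        ≤⟨ ∑-mono-≤ Ss (λ S → *-monoʳ-≤ (0≤weight p (<⇒≤ 0<p) p≤1 S) (2λx≤𝟙+[λx]² mono S)) ⟩
      ∑ Ss (λ S → weight p S * (𝟙 (A? S) + (λ′ * x S) * (λ′ * x S)))
        ≈⟨ ∑-cong Ss (λ S → regroup (weight p S) (𝟙 (A? S)) λ′ (x S)) ⟩
      ∑ Ss (λ S → 𝟙 (A? S) * weight p S + λ′ * λ′ * (weight p S * (x S * x S)))
        ≈⟨ ∑-distrib-+ Ss _ _ ⟩
      ∑ Ss (λ S → 𝟙 (A? S) * weight p S) + ∑ Ss (λ S → λ′ * λ′ * (weight p S * (x S * x S)))
        ≈⟨ +-cong (∑-filter A? Ss (weight p)) (*-distribˡ-∑ _ Ss _) ⟨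
      μ p A? + λ′ * λ′ * ∑ Ss (λ S → weight p S * (x S * x S))
        ≤⟨ +-monoʳ-≤ (μ p A?) (*-monoʳ-≤ (0≤x*y 0≤λ′ 0≤λ′) second-moment-≤) ⟩
      μ p A? + λ′ * λ′ * (E * D)
        ≈⟨ +-congˡ (solve 3 (λ l e d → l :* l :* (e :* d) := (l :* d) :* (l :* e)) refl λ′ E D) ⟩
      μ p A? + λ′ * D * (λ′ * E)
        ≈⟨ +-congˡ (trans (*-congʳ (inverseˡ D 0<D)) (*-identityˡ _)) ⟩
      μ p A? + λ′ * E  ∎)
      where
      regroup : ∀ w t l y → w * (t + (l * y) * (l * y)) ≈ t * w + l * l * (w * (y * y))
      regroup = solve 4 (λ w t l y → w :* (t :+ (l :* y) :* (l :* y)) :=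
                                     t :* w :+ l :* l :* (w :* (y :* y))) refl
      λE≈ : λ′ * E ≈ ∑ Ss (λ S → weight p S * (λ′ * x S))
      λE≈ = begin-equality
        λ′ * E
          ≈⟨ *-congˡ first-moment ⟨
        λ′ * ∑ Ss (λ S → weight p S * x S)
          ≈⟨ *-distribˡ-∑ λ′ Ss _ ⟩
        ∑ Ss (λ S → λ′ * (weight p S * x S))
          ≈⟨ ∑-cong Ss (λ S → solve 3 (λ l w y → l :* (w :* y) := w :* (l :* y)) refl
                                      λ′ (weight p S) (x S)) ⟩
        ∑ Ss (λ S → weight p S * (λ′ * x S))  ∎

    μ≥[E⊓1]/k2^k : Monotone A → μ p A? ≥ (E ⊓ 1#) /ℕ (k *ℕ 2 ^ℕ k)
    μ≥[E⊓1]/k2^k mono = begin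
      e * κ                    ≈⟨ *-identityˡ _ ⟨
      1# * (e * κ)             ≈⟨ *-congʳ (inverseˡ D 0<D) ⟨
      λ′ * D * (e * κ)         ≈⟨ solve 4 (λ l d e k → l :* d :* (e :* k) := l :* k :* (e :* d))
                                    refl λ′ D e κ ⟩
      λ′ * κ * (e * D)         ≤⟨ *-monoʳ-≤ (0≤x*y 0≤λ′ (0≤inverse _ 0<K)) [E⊓1]*D≤E*[k*2^k] ⟩
      λ′ * κ * (E * K)         ≈⟨ solve 4 (λ l k e K → l :* k :* (e :* K) := k :* K :* (l :* e))
                                    refl λ′ κ E K ⟩
      κ * K * (λ′ * E)         ≈⟨ trans (*-congʳ (inverseˡ K 0<K)) (*-identityˡ _) ⟩
      λ′ * E                   ≤⟨ λE≤μ mono ⟩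
      μ p A?                   ∎
      where
      e = E ⊓ 1#
      K = fromℕ (k *ℕ 2 ^ℕ k)
      0<K : 0# < K
      0<K = fromℕ-pos (k *ℕ 2 ^ℕ k)
      κ = inverse K 0<K

lemma4p1 : ∀ {c ℓ₁ ℓ₂ a} (F : OrderedField c ℓ₁ ℓ₂) →
    let open OrderedField F
        open RandomSubset F in
    (n k : ℕ) .{{_ : NonZero k}}
    (p : Carrier) (0<p : 0# < p) → p ≤ 1# →
    (A : Pred (Subset (suc n)) a) (A? : Decidable A) →
    Monotone A → MintermsOfSizeAtMost k A → Tame k p 0<p A? →
    μ p A? ≥ (𝔼 p (λ S → fromℕ (X A? S)) ⊓ 1#) /ℕ (k *ℕ 2 ^ℕ k)
lemma4p1 F n k p 0<p p≤1 A A? mono size≤k tame =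
  ≤-trans
    (*-monoˡ-≤ (0≤inverse _ (fromℕ-pos (k *ℕ 2 ^ℕ k))) (⊓-monoˡ-≤ 1# (≤-reflexive 𝔼X≈E)))
    (μ≥[E⊓1]/k2^k k size≤k tame mono)
  where
  open OrderedField F
  open OrderedFieldProperties F
  open SecondMoment F p 0<p p≤1 A?
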